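{- Let $f,g,h$ be elementary algebraic expressions of identity relaxed logical formulas, regarded as functions of their variables, which take values in $\{ -1,1\}$. Then, with the operations $f\wedge g=\frac12(f+1)(g+1)-1$, $f\vee g=-\frac12(f-1)(g-1)+1$ and $\overline f=-f$, the axioms of Boolean algebra are satisfied: 1. $f\vee g=g\vee f$, $f\wedge g=g\wedge f$; 2. $f\vee(g\vee h)=(f\vee g)\vee h$, $f\wedge(g\wedge h)=(f\wedge g)\wedge h$; 3. $(f\wedge g)\vee g=g$, $(f\vee g)\wedge g=g$; 4. $f\wedge(g\vee h)=(f\wedge g)\vee(f\wedge h)$, $f\vee(g\wedge h)=(f\vee g)\wedge(f\vee h)$; 5. $(f\wedge\overline f)\vee g=g$, $(f\vee\overline f)\wedge g=g$.
   Context: True is encoded as $1$ and false as $-1$. Identity relaxed logical formula: given a CNF formula with $M$ clauses of three literals each and $N$ variables $X_1,\dots,X_N$ (each occurring $r_i\ge1$ times), number the literal occurrences $1,\dots,3M$ (clause $c$ consists of occurrences $3c-2,3c-1,3c$), replace the $a$-th occurrence (positive or negated) by a new variable $x_a$, let $x_{ij}$ be the new variable of the $j$-th occurrence of $X_i$, and $e_{ij}=1$ or $-1$ according to whether that occurrence is positive or negative. The identity relaxed logical formula is the conjunction of all the clauses $x_{3c-2}\vee x_{3c-1}\vee x_{3c}$ and, for each $i$, of the formula asserting that the values $e_{ij}x_{ij}$ ($1\le j\le r_i$) are all true or all false. Its elementary algebraic expression is $$\frac{1}{2^{6M-1}}\prod_{c=1}^{M}\bigl((x_{3c-2}-1)(x_{3c-1}-1)(x_{3c}-1)+8\bigr)\prod_{i=1}^{N}\Bigl(\prod_{j=1}^{r_i}(e_{ij}x_{ij}+1)+\prod_{j=1}^{r_i}(-e_{ij}x_{ij}+1)\Bigr)-1,$$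 which takes on $\{ -1,1\}^{3M}$ the encoded truth value ($1$ or $-1$) of the formula. -}

module Defs where

open import Algebra.Bundles using (CommutativeRing)
open import Data.Fin.Base using (Fin; combine; remQuot)
open import Data.Fin.Patterns using (0F; 1F; 2F)
open import Data.Fin.Properties using (_≟_)
open import Data.List.Base using (List; allFin; filter; length; lookup)
open import Data.Nat.Base as ℕ using (ℕ)
open import Data.Product.Base using (uncurry)
open import Data.Rational.Base using (ℚ; 1ℚ; ½; _+_; _-_; _*_; -_)
open import Data.Rational.Properties using (+-*-commutativeRing; *-1-commutativeMonoid)
open import Data.Sign.Base using (Sign)
open import Data.Sum.Base using (_⊎_)
open import Function.Base using (_∘_)
open import Function.Bundles using (_↣_; Injection)
open import Relation.Binary.PropositionalEquality.Core using (_≡_)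

open import Algebra.Properties.CommutativeMonoid.Sum *-1-commutativeMonoid public
  using () renaming (sum to ∏)
open import Algebra.Properties.Semiring.Exp (CommutativeRing.semiring +-*-commutativeRing) public
  using (_^_)

2ℚ 8ℚ : ℚ
2ℚ = 1ℚ + 1ℚ
8ℚ = 2ℚ ^ 3

record Literal (N : ℕ) : Set where
  constructor literal
  field
    sign : Sign
    var  : Fin N

open Literal public

-- The literal occurrences are the elements of Fin (M * 3): position k of
-- clause c is occurrence combine c k = 3c + k, counting from 0.
record CNF (M N : ℕ) : Set where
  field
    clause : Fin M → Fin 3 → Literal N

  occurrence : Fin (M ℕ.* 3) → Literal N
  occurrence a = uncurry clause (remQuot 3 a)

  occurrencesOf : Fin N → List (Fin (M ℕ.* 3))
  occurrencesOf i = filter (λ a → var (occurrence a) ≟ i) (allFin (M ℕ.* 3))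

  r : Fin N → ℕ
  r i = length (occurrencesOf i)

  field
    r≥1 : ∀ i → 1 ℕ.≤ r i

signValue : Sign → ℚ
signValue Sign.+ = 1ℚ
signValue Sign.- = - 1ℚ

-- The new variables of the identity relaxed formula of φ are indexed by the
-- occurrences of φ. The factor 2 · (1/2)^(6M) is 1/2^(6M-1); written this way
-- it is also correct for M = 0, where truncated subtraction would not be.
module _ {M N : ℕ} (φ : CNF M N) where
  open CNF φ

  elementary : (Fin (M ℕ.* 3) → ℚ) → ℚ
  elementary x =
    2ℚ * ½ ^ (6 ℕ.* M)
      * ∏ (λ c → (xc c 0F - 1ℚ) * (xc c 1F - 1ℚ) * (xc c 2F - 1ℚ) + 8ℚ)
      * ∏ (λ i → ∏ (λ j → e i j * xv i j + 1ℚ) + ∏ (λ j → - e i j * xv i j + 1ℚ))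
      - 1ℚ
    where
    xc : Fin M → Fin 3 → ℚ
    xc c k = x (combine c k)

    xv : (i : Fin N) → Fin (r i) → ℚ
    xv i j = x (lookup (occurrencesOf i) j)

    e : (i : Fin N) → Fin (r i) → ℚ
    e i j = signValue (sign (occurrence (lookup (occurrencesOf i) j)))

-- Several formulas have to be compared as functions on one domain, so each
-- names its new variables injectively in a common set V; different formulas
-- may share variables or not.
record IdentityRelaxedFormula (V : Set) : Set where
  field
    {M N} : ℕ
    cnf   : CNF M N
    name  : Fin (M ℕ.* 3) ↣ V

Fun : Set → Set
Fun V = (V → ℚ) → ℚ

elementaryExpression : {V : Set} → IdentityRelaxedFormula V → Fun V
elementaryExpression F x = elementary cnf (x ∘ Injection.to name)
  where open IdentityRelaxedFormula F

module _ {V : Set} where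

  infix  8 ~_
  infixr 7 _∧_
  infixr 6 _∨_
  infix  4 _≐_

  _∧_ _∨_ : Fun V → Fun V → Fun V
  (f ∧ g) x = ½ * (f x + 1ℚ) * (g x + 1ℚ) - 1ℚ
  (f ∨ g) x = - ½ * (f x - 1ℚ) * (g x - 1ℚ) + 1ℚ

  ~_ : Fun V → Fun V
  (~ f) x = - f x

  -- Equality as functions on {-1,1}^V.
  _≐_ : Fun V → Fun V → Set
  f ≐ g = ∀ x → (∀ v → x v ≡ - 1ℚ ⊎ x v ≡ 1ℚ) → f x ≡ g x

{-# OPTIONS --safe #-}

-- On sign assignments every clause factor is 0 or 8 and, because r i ≥ 1, every
-- variable factor is 0 or 2 ^ r i. The numbers r i add up to 3M, so the product
-- of all the factors is 0 or 8 ^ M * 2 ^ (3M) = 2 ^ (6M), and an elementary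
-- expression is -1 or 1. The axioms are then identities between functions of
-- three signs, which are decided by evaluation.
module Submission where

open import Algebra.Bundles using (CommutativeRing)
open import Data.Bool.Base using (if_then_else_; true; false)
open import Data.Fin.Base using (Fin; zero; suc)
import Data.Fin.Properties as Fin
open import Data.List.Base using (List; []; _∷_; allFin; filter; length; lookup)
open import Data.List.Properties using (length-tabulate)
open import Data.List.Relation.Unary.All using (All; []; _∷_; all?)
import Data.Nat.Base as ℕ
import Data.Nat.Properties as ℕ
open import Data.Product.Base using (_×_; _,_)
open import Data.Rational.Base using (ℚ; 0ℚ; 1ℚ; ½; _+_; _-_; _*_; -_)
open import Data.Rational.Properties
  using (_≟_; *-assoc; *-identityˡ; *-identityʳ; *-zeroˡ; *-zeroʳ; +-identityˡ; +-identityʳ;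
         +-*-commutativeRing; *-1-commutativeMonoid)
open import Data.Sign.Base using (Sign)
open import Data.Sum.Base using (_⊎_; inj₁; inj₂; map)
open import Function.Base using (_∘_; const; id)
open import Function.Bundles using (Injection)
open import Relation.Binary.PropositionalEquality
  using (_≡_; refl; sym; trans; cong; cong₂; subst; module ≡-Reasoning)
open import Relation.Nullary.Decidable using (Dec; does; True; toWitness; _⊎-dec_)

open import Algebra.Properties.CommutativeMonoid.Sum *-1-commutativeMonoid
  using () renaming (sum-replicate to ∏-replicate; sum-replicate-zero to ∏-replicate-1;
                     sum-cong-≗ to ∏-cong; ∑-distrib-+ to ∏-distrib-*)
open import Algebra.Properties.CommutativeSemiring.Exp
  (CommutativeRing.commutativeSemiring +-*-commutativeRing)
  using (^-assocʳ; ^-distrib-*)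

open import Defs

IsSign : ℚ → Set
IsSign t = t ≡ - 1ℚ ⊎ t ≡ 1ℚ

signs : List ℚ
signs = - 1ℚ ∷ 1ℚ ∷ []

lookup-sign : ∀ {P : ℚ → Set} → All P signs → ∀ {t} → IsSign t → P t
lookup-sign (p ∷ _)      (inj₁ refl) = p
lookup-sign (_ ∷ q ∷ []) (inj₂ refl) = q

-- The implicit argument is the check of all eight sign triples; for a closed `P?` it evaluates to
-- the unit type and is filled in automatically.
decide-signs : {P : ℚ → ℚ → ℚ → Set} (P? : ∀ a b c → Dec (P a b c)) →
  {_ : True (all? (λ a → all? (λ b → all? (P? a b) signs) signs) signs)} →
  ∀ {a b c} → IsSign a → IsSign b → IsSign c → P a b c
decide-signs P? {w} sa sb sc =
  lookup-sign (lookup-sign (lookup-sign (toWitness w) sa) sb) sc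

signValue-isSign : ∀ s → IsSign (signValue s)
signValue-isSign Sign.- = inj₁ refl
signValue-isSign Sign.+ = inj₂ refl

-- This form passes to products: the values `c` multiply, and a single vanishing factor gives 0.
ZeroOr : ℚ → ℚ → Set
ZeroOr c t = t ≡ 0ℚ ⊎ t ≡ c

zeroOr? : ∀ c t → Dec (ZeroOr c t)
zeroOr? c t = (t ≟ 0ℚ) ⊎-dec (t ≟ c)

zeroOr-* : ∀ {c d s t} → ZeroOr c s → ZeroOr d t → ZeroOr (c * d) (s * t)
zeroOr-* {t = t} (inj₁ refl) _           = inj₁ (*-zeroˡ t)
zeroOr-* {s = s} (inj₂ _)    (inj₁ refl) = inj₁ (*-zeroʳ s)
zeroOr-*         (inj₂ p)    (inj₂ q)    = inj₂ (cong₂ _*_ p q)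

-- The last hypothesis excludes the sum `c + c`.
zeroOr-+ : ∀ {c s t} → ZeroOr c s → ZeroOr c t → s ≡ 0ℚ ⊎ t ≡ 0ℚ → ZeroOr c (s + t)
zeroOr-+ {c} {t = t} _ q (inj₁ refl) = subst (ZeroOr c) (sym (+-identityˡ t)) q
zeroOr-+ {c} {s = s} p _ (inj₂ refl) = subst (ZeroOr c) (sym (+-identityʳ s)) p

zeroOr-∏ : ∀ n {c t : Fin n → ℚ} → (∀ i → ZeroOr (c i) (t i)) → ZeroOr (∏ c) (∏ t)
zeroOr-∏ ℕ.zero    p = inj₂ refl
zeroOr-∏ (ℕ.suc n) p = zeroOr-* (p zero) (zeroOr-∏ n (p ∘ suc))

∏-head≡0 : ∀ {n} (t : Fin (ℕ.suc n) → ℚ) → t zero ≡ 0ℚ → ∏ t ≡ 0ℚ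
∏-head≡0 t p = trans (cong (_* ∏ (t ∘ suc)) p) (*-zeroˡ (∏ (t ∘ suc)))

zeroOr-∏-^ : ∀ n {c} {t : Fin n → ℚ} → (∀ i → ZeroOr c (t i)) → ZeroOr (c ^ n) (∏ t)
zeroOr-∏-^ n {t = t} p = subst (λ d → ZeroOr d (∏ t)) (∏-replicate n) (zeroOr-∏ n p)

zeroOr-clause : ∀ {a b c} → IsSign a → IsSign b → IsSign c →
  ZeroOr 8ℚ ((a - 1ℚ) * (b - 1ℚ) * (c - 1ℚ) + 8ℚ)
zeroOr-clause = decide-signs (λ a b c → zeroOr? 8ℚ ((a - 1ℚ) * (b - 1ℚ) * (c - 1ℚ) + 8ℚ))

-- Each factor is 0 or 2, and the two products are never both nonzero. For `n = 0` both would be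
-- empty, with sum 2 instead of `2ℚ ^ 0`.
zeroOr-identity : ∀ {n} → 1 ℕ.≤ n → {e x : Fin n → ℚ} →
  (∀ j → IsSign (e j)) → (∀ j → IsSign (x j)) →
  ZeroOr (2ℚ ^ n) (∏ (λ j → e j * x j + 1ℚ) + ∏ (λ j → - e j * x j + 1ℚ))
zeroOr-identity {ℕ.suc n} _ {e} {x} se sx = zeroOr-+
  (zeroOr-∏-^ (ℕ.suc n) λ j →
    decide-signs (λ a b _ → zeroOr? 2ℚ (a * b + 1ℚ)) (se j) (sx j) (sx j))
  (zeroOr-∏-^ (ℕ.suc n) λ j →
    decide-signs (λ a b _ → zeroOr? 2ℚ (- a * b + 1ℚ)) (se j) (sx j) (sx j))
  -- `e zero * x zero` is -1 or 1, so the first factor of one of the two products is 0.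
  (map (∏-head≡0 λ j → e j * x j + 1ℚ) (∏-head≡0 λ j → - e j * x j + 1ℚ)
    (decide-signs (λ a b _ → (a * b + 1ℚ ≟ 0ℚ) ⊎-dec (- a * b + 1ℚ ≟ 0ℚ))
      (se zero) (sx zero) (sx zero)))

1^n≡1 : ∀ n → 1ℚ ^ n ≡ 1ℚ
1^n≡1 n = trans (sym (∏-replicate n)) (∏-replicate-1 n)

-- Comparing successors reduces to comparing predecessors, so below `suc k` the tail is the same
-- product for `k`.
∏-single : ∀ {n} c (k : Fin n) → ∏ (λ i → if does (k Fin.≟ i) then c else 1ℚ) ≡ c
∏-single {ℕ.suc n} c zero    = trans (cong (c *_) (∏-replicate-1 n)) (*-identityʳ c)
∏-single           c (suc k) = trans (*-identityˡ _) (∏-single c k)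

-- Each element of `xs` lies in exactly one fibre of `key`, so it contributes exactly one factor `c`
-- to the left side as well.
∏-fibres : ∀ {A : Set} {n} c (key : A → Fin n) xs →
  ∏ (λ i → c ^ length (filter (λ a → key a Fin.≟ i) xs)) ≡ c ^ length xs
∏-fibres {n = n} c key []       = ∏-replicate-1 n
∏-fibres {n = n} c key (a ∷ xs) = begin
  ∏ (λ i → c ^ fibre (a ∷ xs) i)        ≡⟨ ∏-cong split ⟩
  ∏ (λ i → δ i * c ^ fibre xs i)        ≡⟨ ∏-distrib-* δ (λ i → c ^ fibre xs i) ⟩
  ∏ δ * ∏ (λ i → c ^ fibre xs i)        ≡⟨ cong₂ _*_ (∏-single c (key a)) (∏-fibres c key xs) ⟩
  c * c ^ length xs                     ∎
  where
  open ≡-Reasoning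

  fibre : List _ → Fin n → ℕ.ℕ
  fibre ys i = length (filter (λ b → key b Fin.≟ i) ys)

  δ : Fin n → ℚ
  δ i = if does (key a Fin.≟ i) then c else 1ℚ

  split : ∀ i → c ^ fibre (a ∷ xs) i ≡ δ i * c ^ fibre xs i
  split i with does (key a Fin.≟ i)
  ... | true  = refl
  ... | false = sym (*-identityˡ _)

-- Per clause, 8 comes from the clause factor and `2ℚ ^ 3` from its three occurrences; `½ ^ 6`
-- cancels both.
normalisation : ∀ M → ½ ^ (6 ℕ.* M) * (8ℚ ^ M * 2ℚ ^ (M ℕ.* 3)) ≡ 1ℚ
normalisation M = begin
  ½ ^ (6 ℕ.* M) * (8ℚ ^ M * 2ℚ ^ (M ℕ.* 3))
    ≡⟨ cong₂ (λ a b → a * (8ℚ ^ M * b)) (sym (^-assocʳ ½ 6 M))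
        (trans (cong (2ℚ ^_) (ℕ.*-comm M 3)) (sym (^-assocʳ 2ℚ 3 M))) ⟩
  (½ ^ 6) ^ M * (8ℚ ^ M * 8ℚ ^ M)
    ≡⟨ cong ((½ ^ 6) ^ M *_) (^-distrib-* 8ℚ 8ℚ M) ⟨
  (½ ^ 6) ^ M * (8ℚ * 8ℚ) ^ M
    ≡⟨ ^-distrib-* (½ ^ 6) (8ℚ * 8ℚ) M ⟨
  (½ ^ 6 * (8ℚ * 8ℚ)) ^ M
    -- The base `½ ^ 6 * (8ℚ * 8ℚ)` evaluates to 1.
    ≡⟨ 1^n≡1 M ⟩
  1ℚ ∎
  where open ≡-Reasoning

-- The factor `k` scales the possible values 0 and `c * d` of `s * t` to 0 and 1, which
-- `2ℚ * v - 1ℚ` sends to -1 and 1.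
rescaled-isSign : ∀ k c d {s t} → k * (c * d) ≡ 1ℚ → ZeroOr c s → ZeroOr d t →
  IsSign (2ℚ * k * s * t - 1ℚ)
rescaled-isSign k c d {s} {t} kcd≡1 p q =
  map (λ st≡0 → eval (trans (cong (k *_) st≡0) (*-zeroʳ k)))
      (λ st≡cd → eval (trans (cong (k *_) st≡cd) kcd≡1))
      (zeroOr-* p q)
  where
  open ≡-Reasoning

  eval : ∀ {v} → k * (s * t) ≡ v → 2ℚ * k * s * t - 1ℚ ≡ 2ℚ * v - 1ℚ
  eval {v} eq = cong (_- 1ℚ) (begin
    2ℚ * k * s * t     ≡⟨ *-assoc (2ℚ * k) s t ⟩
    2ℚ * k * (s * t)   ≡⟨ *-assoc 2ℚ k (s * t) ⟩
    2ℚ * (k * (s * t)) ≡⟨ cong (2ℚ *_) eq ⟩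
    2ℚ * v             ∎)

elementary-isSign : ∀ {M N} (φ : CNF M N) x → (∀ a → IsSign (x a)) → IsSign (elementary φ x)
elementary-isSign {M} {N} φ x sx = rescaled-isSign
  (½ ^ (6 ℕ.* M)) (8ℚ ^ M) (2ℚ ^ (M ℕ.* 3)) (normalisation M)
  (zeroOr-∏-^ M λ c → zeroOr-clause (sx _) (sx _) (sx _))
  (map id (λ p → trans p ∏2^r≡2^3M)
    (zeroOr-∏ N λ i → zeroOr-identity (r≥1 i)
      (λ j → signValue-isSign (sign (occurrence (lookup (occurrencesOf i) j))))
      (λ j → sx (lookup (occurrencesOf i) j))))
  where
  open CNF φ

  -- The numbers `r i` are the fibre sizes of the map from the 3M occurrences to their variables.
  ∏2^r≡2^3M : ∏ (λ i → 2ℚ ^ r i) ≡ 2ℚ ^ (M ℕ.* 3)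
  ∏2^r≡2^3M = trans (∏-fibres 2ℚ (var ∘ occurrence) (allFin (M ℕ.* 3)))
                     (cong (2ℚ ^_) (length-tabulate {n = M ℕ.* 3} id))

module _ {V : Set} where

  -- Elementary expressions enter the axioms through this property.
  SignValued : Fun V → Set
  SignValued f = ∀ x → (∀ v → IsSign (x v)) → IsSign (f x)

  elementaryExpression-signValued : ∀ F → SignValued (elementaryExpression F)
  elementaryExpression-signValued F x sx = elementary-isSign cnf _ (sx ∘ Injection.to name)
    where open IdentityRelaxedFormula F

  module _ {f g h : Fun V} (sf : SignValued f) (sg : SignValued g) (sh : SignValued h) where

    -- The operations are pointwise, so at a given x an identity may be checked
    -- on constant functions.
    pointwise : (l r : Fun V → Fun V → Fun V → Fun V) → ∀ x →
      let l′ = λ a b c → l (const a) (const b) (const c) x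
          r′ = λ a b c → r (const a) (const b) (const c) x
      in {_ : True (all? (λ a → all? (λ b → all? (λ c → l′ a b c ≟ r′ a b c) signs) signs) signs)} →
      (∀ v → IsSign (x v)) → l′ (f x) (g x) (h x) ≡ r′ (f x) (g x) (h x)
    pointwise l r x {w} sx = decide-signs
      (λ a b c → l (const a) (const b) (const c) x ≟ r (const a) (const b) (const c) x)
      {w} (sf x sx) (sg x sx) (sh x sx)

    booleanAxioms :
        ((f ∨ g ≐ g ∨ f) × (f ∧ g ≐ g ∧ f))
      × ((f ∨ (g ∨ h) ≐ (f ∨ g) ∨ h) × (f ∧ (g ∧ h) ≐ (f ∧ g) ∧ h))
      × (((f ∧ g) ∨ g ≐ g) × ((f ∨ g) ∧ g ≐ g))
      × ((f ∧ (g ∨ h) ≐ (f ∧ g) ∨ (f ∧ h)) × (f ∨ (g ∧ h) ≐ (f ∨ g) ∧ (f ∨ h)))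
      × (((f ∧ (~ f)) ∨ g ≐ g) × ((f ∨ (~ f)) ∧ g ≐ g))
    booleanAxioms =
        -- Constant functions ignore `x`, so each check of sign triples is a closed computation
        -- although `x` is a variable.
        ( (λ x → pointwise (λ a b c → a ∨ b) (λ a b c → b ∨ a) x)
        , (λ x → pointwise (λ a b c → a ∧ b) (λ a b c → b ∧ a) x))
      , ( (λ x → pointwise (λ a b c → a ∨ (b ∨ c)) (λ a b c → (a ∨ b) ∨ c) x)
        , (λ x → pointwise (λ a b c → a ∧ (b ∧ c)) (λ a b c → (a ∧ b) ∧ c) x))
      , ( (λ x → pointwise (λ a b c → (a ∧ b) ∨ b) (λ a b c → b) x)
        , (λ x → pointwise (λ a b c → (a ∨ b) ∧ b) (λ a b c → b) x))
      , ( (λ x → pointwise (λ a b c → a ∧ (b ∨ c)) (λ a b c → (a ∧ b) ∨ (a ∧ c)) x)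
        , (λ x → pointwise (λ a b c → a ∨ (b ∧ c)) (λ a b c → (a ∨ b) ∧ (a ∨ c)) x))
      , ( (λ x → pointwise (λ a b c → (a ∧ (~ a)) ∨ b) (λ a b c → b) x)
        , (λ x → pointwise (λ a b c → (a ∨ (~ a)) ∧ b) (λ a b c → b) x))

theorem7 : {V : Set} (F G H : IdentityRelaxedFormula V) →
    let f = elementaryExpression F
        g = elementaryExpression G
        h = elementaryExpression H
    in ((f ∨ g ≐ g ∨ f) × (f ∧ g ≐ g ∧ f))
     × ((f ∨ (g ∨ h) ≐ (f ∨ g) ∨ h) × (f ∧ (g ∧ h) ≐ (f ∧ g) ∧ h))
     × (((f ∧ g) ∨ g ≐ g) × ((f ∨ g) ∧ g ≐ g))
     × ((f ∧ (g ∨ h) ≐ (f ∧ g) ∨ (f ∧ h)) × (f ∨ (g ∧ h) ≐ (f ∨ g) ∧ (f ∨ h)))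
     × (((f ∧ (~ f)) ∨ g ≐ g) × ((f ∨ (~ f)) ∧ g ≐ g))
theorem7 F G H = booleanAxioms
  {f = elementaryExpression F} {elementaryExpression G} {elementaryExpression H}
  (elementaryExpression-signValued F)
  (elementaryExpression-signValued G)
  (elementaryExpression-signValued H)
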